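{- For every finite simple graph $G$, $Z_f^+(G) = a_\star^+(G)$.
   Context: For $r\in\mathbb{N}$, the $r$-blowup $G^{(r)}$ is obtained by replacing each vertex $u$ of $G$ by an independent set $R_u$ of $r$ vertices (a cluster) and each edge $uw$ by all edges between $R_u$ and $R_w$. $r$-fold PSD forcing game: an initial set $B\subseteq V(G^{(r)})$ is blue, the rest white. A forcing process is a sequence of steps. In an ordinary step, with $B_t$ the current blue set and $W_1,\dots,W_h$ the vertex sets of the connected components of $G^{(r)}-B_t$, a vertex $u\in B_t$ with $|N(u)\cap W_i|\le r$ for some $i$ colors all of $N(u)\cap W_i$ blue. Forcing processes may also use backforcing steps: if a vertex of a cluster $R_u$ that is not entirely blue has just performed a force, then at the next step all vertices of $R_u$ may be colored blue. $B$ is an $r$-fold PSD forcing set if some forcing process makes all of $G^{(r)}$ blue. $Z_{(r)}^+(G)$ is the minimum cardinality of such a set, and $Z_f^+(G)=\inf_{r\in\mathbb{N}}Z_{(r)}^+(G)/r$. A cluster is forced at a step if some of its vertices turn from white to blue at that step. Relative to a coloring, a cluster is an All cluster (all vertices blue), a One cluster (exactly one vertex blue) or a None cluster (all white). An AON $r$-fold PSD forcing set is an $r$-fold PSD forcing set $B$ for which every cluster of $G^{(r)}$ colored with $B$ is an All, One or None cluster; $a(B)$ and $\ell(B)$ denote its numbers of All and One clusters. An optimal AON $r$-fold PSD forcing set is an AON $r$-fold PSD forcing set of cardinality $Z_{(r)}^+(G)$ for which there exists a forcing process starting from it in which exactly one cluster is forced at each step. For $G$ with $n$ vertices, optimal AON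 $n$-fold PSD forcing sets exist and all have the same number of All clusters; this number is denoted $a_\star^+(G)$. -}

module Defs where

open import Data.Nat using (ℕ; zero; suc; _+_; _*_; _≤_)
open import Data.Bool using (Bool; true; false; T; if_then_else_)
open import Data.Fin using (Fin)
open import Data.List using (List; length; map; allFin)
open import Data.Nat.ListAction using (sum)
open import Data.Bool.ListAction using (all)
open import Data.List.Membership.Propositional using (_∈_)
open import Data.Maybe using (Maybe; just; nothing)
open import Data.Product using (Σ; ∃; _×_; _,_; proj₁; proj₂)
open import Data.Sum using (_⊎_)
open import Relation.Nullary using (¬_)
open import Relation.Binary.PropositionalEquality using (_≡_)
open import Relation.Binary.Construct.Closure.ReflexiveTransitive using (Star)
open import Function using (_⇔_)

record SimpleGraph (n : ℕ) : Set where
  field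
    adj        : Fin n → Fin n → Bool
    adj-sym    : ∀ u v → adj u v ≡ adj v u
    adj-irrefl : ∀ u → adj u u ≡ false

open SimpleGraph public

module Blowup {n : ℕ} (G : SimpleGraph n) (r : ℕ) where

  -- vertices of G^(r): vertex (u , i) is the i-th vertex of cluster R_u
  Vtx : Set
  Vtx = Fin n × Fin r

  BAdj : Vtx → Vtx → Set
  BAdj (u , _) (w , _) = T (adj G u w)

  ColSet : Set₁
  ColSet = Vtx → Set

  data Conn (B : ColSet) : Vtx → Vtx → Set where
    here  : ∀ {x} → Conn B x x
    there : ∀ {x y z} → Conn B x y → ¬ B z → BAdj y z → Conn B x z

  AtMost : ℕ → (Vtx → Set) → Set
  AtMost k S = Σ (List Vtx) λ xs → length xs ≤ k × (∀ v → S v → v ∈ xs)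

  NbrIn : ColSet → Vtx → Vtx → Vtx → Set
  NbrIn B u w v = BAdj u v × ¬ B v × Conn B w v

  -- state of a forcing process: blue set and the vertex that performed the
  -- force at the previous step (if the previous step was an ordinary force)
  State : Set₁
  State = ColSet × Maybe Vtx

  data Step : State → State → Set₁ where
    force : ∀ {B B' last} (u w : Vtx) → B u → ¬ B w →
            AtMost r (NbrIn B u w) →
            (∃ λ v → NbrIn B u w v) →
            (∀ v → B' v ⇔ (B v ⊎ NbrIn B u w v)) →
            Step (B , last) (B' , just u)
    back  : ∀ {B B'} (u : Vtx) →
            (∃ λ i → ¬ B (proj₁ u , i)) →
            (∀ v → B' v ⇔ (B v ⊎ proj₁ v ≡ proj₁ u)) →
            Step (B , just u) (B' , nothing)

  toSet : (Vtx → Bool) → ColSet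
  toSet B v = T (B v)

  IsForcingSet : (Vtx → Bool) → Set₁
  IsForcingSet B = Σ State λ s → Star Step (toSet B , nothing) s × (∀ v → proj₁ s v)

  card : (Vtx → Bool) → ℕ
  card B = sum (map (λ u → sum (map (λ i → if B (u , i) then 1 else 0) (allFin r))) (allFin n))

  IsZ : ℕ → Set₁
  IsZ k = (Σ (Vtx → Bool) λ B → IsForcingSet B × card B ≡ k)
        × (∀ B → IsForcingSet B → k ≤ card B)

  ClusterForced : ColSet → ColSet → Fin n → Set
  ClusterForced B B' c = ∃ λ i → ¬ B (c , i) × B' (c , i)

  ExactlyOneForced : ColSet → ColSet → Set
  ExactlyOneForced B B' =
    Σ (Fin n) λ c → ClusterForced B B' c × (∀ c' → ClusterForced B B' c' → c' ≡ c)

  StepOne : State → State → Set₁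
  StepOne s s' = Step s s' × ExactlyOneForced (proj₁ s) (proj₁ s')

  ForcingOneClusterPerStep : (Vtx → Bool) → Set₁
  ForcingOneClusterPerStep B =
    Σ State λ s → Star StepOne (toSet B , nothing) s × (∀ v → proj₁ s v)

  IsAll IsOne IsNone : (Vtx → Bool) → Fin n → Set
  IsAll B u = ∀ i → B (u , i) ≡ true
  IsOne B u = Σ (Fin r) λ i → B (u , i) ≡ true × (∀ j → B (u , j) ≡ true → j ≡ i)
  IsNone B u = ∀ i → B (u , i) ≡ false

  IsAON : (Vtx → Bool) → Set
  IsAON B = ∀ u → IsAll B u ⊎ IsOne B u ⊎ IsNone B u

  numAll : (Vtx → Bool) → ℕ
  numAll B = sum (map (λ u → if all (λ i → B (u , i)) (allFin r) then 1 else 0) (allFin n))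

  IsOptimalAON : (Vtx → Bool) → Set₁
  IsOptimalAON B = IsAON B × IsForcingSet B × IsZ (card B) × ForcingOneClusterPerStep B

open Blowup public

-- IsZfPlus G a : a = Z_f^+(G) = inf_{r ≥ 1} Z_(r)^+(G) / r,
-- i.e. a is a lower bound and every rational lower bound p/q is ≤ a
-- (negative rationals being trivially ≤ a).
IsZfPlus : ∀ {n} → SimpleGraph n → ℕ → Set₁
IsZfPlus G a =
  (∀ r → 1 ≤ r → ∀ k → IsZ G r k → a * r ≤ k)
  × (∀ p q → 1 ≤ q → (∀ r → 1 ≤ r → ∀ k → IsZ G r k → p * r ≤ k * q) → p ≤ a * q)

{-# OPTIONS --safe #-}
module Submission where

-- Contracting every cluster of the blowup to a vertex turns the AON game into a game on G whose
-- rules do not mention r: it starts from a set D of All clusters and uses some number ℓ ≤ n / 2 of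
-- One clusters, at a total cost of r |D| + ℓ.  Conversely any forcing process in the blowup can be
-- simplified to this game without raising the cost: if a step forces several clusters at once, at most r
-- of their vertices were white, so all but one of them may be taken as All clusters from the start.
-- Hence Z_(r) is the minimum of r |D| + ℓ over all winning pairs, for every r ≥ 1.  Since ℓ < n,
-- for r = n the minimum has the least possible |D|, and this |D| is also lim Z_(r) / r.
--
-- Blue sets need not be decidable, so processes are analysed under double negation; the
-- inequalities obtained are decidable and the game itself is decidable by exhaustive search.

open import Defs
open import Data.Product using (Σ; ∃; _×_; _,_; proj₁; proj₂)
open import Data.Product.Properties using (≡-dec)
open import Data.Bool using (Bool; true; false; T; not; _∧_; _∨_; if_then_else_)
open import Data.Bool.Properties using (T?; T-≡; T-∧; T-∨)
open import Data.Bool.ListAction using (all)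
open import Data.Fin using (Fin; zero; suc; toℕ; fromℕ<)
open import Data.Fin.Properties
  using (_≟_; any?; all?; suc-injective; toℕ-injective; toℕ-fromℕ<; toℕ<n; sequence)
open import Data.Fin.Subset using (Subset; ∣_∣; ⊤; ⊥)
open import Data.Fin.Subset.Properties using (anySubset?; ∣p∣≤n; ∣⊤∣≡n; ∣⊥∣≡0)
open import Data.List using (List; []; _∷_; length; map; allFin)
open import Data.List.Properties using (map-tabulate; length-map; length-tabulate)
open import Data.List.Membership.Propositional using (_∈_)
open import Data.List.Membership.Propositional.Properties using (∈-map⁺; ∈-allFin)
open import Data.List.Relation.Unary.Any using (here; there)
open import Data.Maybe using (Maybe; just; nothing)
open import Data.Nat using (ℕ; zero; suc; _+_; _*_; _∸_; _≤_; _<_; z≤n; s≤s; _≤?_)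
open import Data.Nat.ListAction using (sum)
open import Data.Nat.Properties hiding (suc-injective) renaming (_≟_ to _≟ℕ_)
open import Data.Nat.Solver using (module +-*-Solver)
open import Data.Sum using (_⊎_; inj₁; inj₂; [_,_]′)
open import Data.Unit using (tt)
open import Data.Vec using (lookup; tabulate; _∷_; []; _[_]≔_)
open import Data.Vec.Properties
  using (lookup∘update; lookup∘update′; []≔-idempotent; []≔-lookup; lookup-replicate; lookup∘tabulate)
open import Effect.Monad using (RawMonad)
open import Function using (_∘_; id; _⇔_; mk⇔; Equivalence)
open import Relation.Binary.Construct.Closure.ReflexiveTransitive using (Star; ε; _◅_; _◅◅_; gmap)
open import Relation.Binary.PropositionalEquality
open import Relation.Nullary using (¬_; Dec; yes; no; contradiction; ¬?; _×-dec_; _⊎-dec_)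
open import Relation.Nullary.Negation using (¬¬-Monad; ¬¬-map)
open import Relation.Nullary.Decidable
  using (map′; decidable-stable; ¬¬-excluded-middle; isYes; toWitness; fromWitness)

open Equivalence using (to; from)
open +-*-Solver using (solve; _:=_; _:+_; _:*_; con)

private
  variable
    n r : ℕ
    A : Set

-- Finite sums

⟦_⟧ : Bool → ℕ
⟦ b ⟧ = if b then 1 else 0

∑ : (Fin n → ℕ) → ℕ
∑ {n} f = sum (map f (allFin n))

∑-suc : (f : Fin (suc n) → ℕ) → ∑ f ≡ f zero + ∑ (f ∘ suc)
∑-suc {n} f = cong (λ xs → f zero + sum xs)
  (trans (map-tabulate suc f) (sym (map-tabulate id (f ∘ suc))))

∑-mono : {f g : Fin n → ℕ} → (∀ c → f c ≤ g c) → ∑ f ≤ ∑ g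
∑-mono {n} {f} {g} f≤g = go (allFin n)
  where
  go : ∀ xs → sum (map f xs) ≤ sum (map g xs)
  go []       = z≤n
  go (c ∷ xs) = +-mono-≤ (f≤g c) (go xs)

∑-cong : {f g : Fin n → ℕ} → (∀ c → f c ≡ g c) → ∑ f ≡ ∑ g
∑-cong f≡g = ≤-antisym (∑-mono (≤-reflexive ∘ f≡g)) (∑-mono (≤-reflexive ∘ sym ∘ f≡g))

∑-+ : (f g : Fin n → ℕ) → ∑ (λ c → f c + g c) ≡ ∑ f + ∑ g
∑-+ {n} f g = go (allFin n)
  where
  go : ∀ xs → sum (map (λ c → f c + g c) xs) ≡ sum (map f xs) + sum (map g xs)
  go []       = refl
  go (c ∷ xs) = trans (cong (f c + g c +_) (go xs))
    (solve 4 (λ a b x y → a :+ b :+ (x :+ y) := a :+ x :+ (b :+ y)) refl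
      (f c) (g c) (sum (map f xs)) (sum (map g xs)))

∑-* : ∀ k (f : Fin n → ℕ) → ∑ (λ c → k * f c) ≡ k * ∑ f
∑-* {n} k f = go (allFin n)
  where
  go : ∀ xs → sum (map (λ c → k * f c) xs) ≡ k * sum (map f xs)
  go []       = sym (*-zeroʳ k)
  go (c ∷ xs) = trans (cong (k * f c +_) (go xs)) (sym (*-distribˡ-+ k (f c) _))

∑-const : ∀ n k → ∑ {n} (λ _ → k) ≡ n * k
∑-const zero    k = refl
∑-const (suc n) k = trans (∑-suc {n} (λ _ → k)) (cong (k +_) (∑-const n k))

∑-zero : (f : Fin n → ℕ) → (∀ c → f c ≡ 0) → ∑ f ≡ 0
∑-zero {n} f f≡0 = trans (∑-cong f≡0) (trans (∑-const n 0) (*-zeroʳ n))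

∑-single : (f : Fin n → ℕ) (d : Fin n) → (∀ c → c ≢ d → f c ≡ 0) → ∑ f ≡ f d
∑-single f zero f≡0 = trans (∑-suc f)
  (trans (cong (f zero +_) (∑-zero (f ∘ suc) (λ c → f≡0 (suc c) λ ()))) (+-identityʳ _))
∑-single f (suc d) f≡0 = trans (∑-suc f)
  (cong₂ _+_ (f≡0 zero λ ()) (∑-single (f ∘ suc) d (λ c c≢d → f≡0 (suc c) (c≢d ∘ suc-injective))))

∑-∣∣ : (D : Subset n) → ∑ (λ c → ⟦ lookup D c ⟧) ≡ ∣ D ∣
∑-∣∣ []          = refl
∑-∣∣ (true ∷ D)  = trans (∑-suc (λ c → ⟦ lookup (true ∷ D) c ⟧)) (cong suc (∑-∣∣ D))
∑-∣∣ (false ∷ D) = trans (∑-suc (λ c → ⟦ lookup (false ∷ D) c ⟧)) (∑-∣∣ D)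

⟦⟧-false : ∀ b → ¬ T b → ⟦ b ⟧ ≡ 0
⟦⟧-false true  ¬b = contradiction tt ¬b
⟦⟧-false false ¬b = refl

⟦⟧-true : ∀ b → T b → ⟦ b ⟧ ≡ 1
⟦⟧-true true _ = refl

¬T⇒≡false : ∀ {b} → ¬ T b → b ≡ false
¬T⇒≡false {true}  ¬b = contradiction tt ¬b
¬T⇒≡false {false} ¬b = refl

if-true : ∀ {b} {x y : A} → T b → (if b then x else y) ≡ x
if-true {b = true} _ = refl

if-false : ∀ {b} {x y : A} → ¬ T b → (if b then x else y) ≡ y
if-false {b = true}  ¬b = contradiction tt ¬b
if-false {b = false} ¬b = refl

T-not : ∀ {b} → ¬ T b → T (not b)
T-not {true}  ¬b = contradiction tt ¬b
T-not {false} ¬b = tt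

T-not⁻ : ∀ {b} → T (not b) → ¬ T b
T-not⁻ {false} _ ()

-- Induction on the list: taking its head out of `P` lowers the count by at most one, and the tail
-- covers the rest. This turns the list in `AtMost` into a bound on a sum.
∑∑-≤-length : (P : Fin n × Fin r → Bool) (xs : List (Fin n × Fin r)) →
              (∀ v → T (P v) → v ∈ xs) → ∑ (λ c → ∑ (λ i → ⟦ P (c , i) ⟧)) ≤ length xs
∑∑-≤-length P [] P⊆ = ≤-reflexive (∑-zero _ λ c → ∑-zero (λ i → ⟦ P (c , i) ⟧) λ i →
  ⟦⟧-false (P (c , i)) λ p → contradiction (P⊆ _ p) λ ())
∑∑-≤-length {n} {r} P (x@(d , j) ∷ xs) P⊆ = begin
  ∑ (λ c → ∑ (λ i → ⟦ P (c , i) ⟧))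
    ≤⟨ ∑-mono (λ c → ∑-mono (λ i → split (c , i))) ⟩
  ∑ (λ c → ∑ (λ i → ⟦ is-x (c , i) ⟧ + ⟦ P′ (c , i) ⟧))
    ≡⟨ ∑-cong (λ c → ∑-+ (λ i → ⟦ is-x (c , i) ⟧) _) ⟩
  ∑ (λ c → ∑ (λ i → ⟦ is-x (c , i) ⟧) + ∑ (λ i → ⟦ P′ (c , i) ⟧))
    ≡⟨ ∑-+ (λ c → ∑ (λ i → ⟦ is-x (c , i) ⟧)) _ ⟩
  ∑ (λ c → ∑ (λ i → ⟦ is-x (c , i) ⟧)) + ∑ (λ c → ∑ (λ i → ⟦ P′ (c , i) ⟧))
    ≤⟨ +-mono-≤ (≤-reflexive one) (∑∑-≤-length P′ xs P′⊆) ⟩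
  suc (length xs) ∎
  where
  open ≤-Reasoning
  is-x P′ : Fin n × Fin r → Bool
  is-x v = isYes (≡-dec _≟_ _≟_ v x)
  P′ v = P v ∧ not (is-x v)
  to-≡ : ∀ {v} → T (is-x v) → v ≡ x
  to-≡ {v} = toWitness {a? = ≡-dec _≟_ _≟_ v x}
  from-≡ : ∀ {v} → v ≡ x → T (is-x v)
  from-≡ {v} = fromWitness {a? = ≡-dec _≟_ _≟_ v x}
  split : ∀ v → ⟦ P v ⟧ ≤ ⟦ is-x v ⟧ + ⟦ P′ v ⟧
  split v with P v | is-x v
  ... | false | _     = z≤n
  ... | true  | true  = s≤s z≤n
  ... | true  | false = s≤s z≤n
  one : ∑ (λ c → ∑ (λ i → ⟦ is-x (c , i) ⟧)) ≡ 1
  one = trans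
    (∑-single _ d λ c c≢d → ∑-zero (λ i → ⟦ is-x (c , i) ⟧) λ i →
      ⟦⟧-false (is-x (c , i)) λ t → c≢d (cong proj₁ (to-≡ t)))
    (trans
      (∑-single (λ i → ⟦ is-x (d , i) ⟧) j λ i i≢j →
        ⟦⟧-false (is-x (d , i)) λ t → i≢j (cong proj₂ (to-≡ t)))
      (⟦⟧-true (is-x x) (from-≡ refl)))
  P′⊆ : ∀ v → T (P′ v) → v ∈ xs
  P′⊆ v p with to T-∧ p
  ... | pv , v≢x with P⊆ v pv
  ...   | here v≡x = contradiction (from-≡ v≡x) (T-not⁻ v≢x)
  ...   | there v∈ = v∈

-- Finite subsets

_∈ˢ_ _∉ˢ_ : Fin n → Subset n → Set
c ∈ˢ D = T (lookup D c)
c ∉ˢ D = ¬ c ∈ˢ D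

∈-insert : ∀ (D : Subset n) w → w ∈ˢ (D [ w ]≔ true)
∈-insert D w = from T-≡ (lookup∘update w D true)

∈-insert⁺ : ∀ (D : Subset n) w {c} → c ∈ˢ D → c ∈ˢ (D [ w ]≔ true)
∈-insert⁺ D w {c} c∈D with c ≟ w
... | yes refl = ∈-insert D w
... | no c≢w   = subst T (sym (lookup∘update′ c≢w D true)) c∈D

∈-insert⁻ : ∀ (D : Subset n) w {c} → c ≢ w → c ∈ˢ (D [ w ]≔ true) → c ∈ˢ D
∈-insert⁻ D w c≢w = subst T (lookup∘update′ c≢w D true)

∉-remove : ∀ (D : Subset n) w → w ∉ˢ (D [ w ]≔ false)
∉-remove D w = subst T (lookup∘update w D false)

∈-remove⁺ : ∀ (D : Subset n) w {c} → c ≢ w → c ∈ˢ D → c ∈ˢ (D [ w ]≔ false)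
∈-remove⁺ D w c≢w = subst T (sym (lookup∘update′ c≢w D false))

∈-remove⁻ : ∀ (D : Subset n) w {c} → c ∈ˢ (D [ w ]≔ false) → c ∈ˢ D
∈-remove⁻ D w {c} c∈ with c ≟ w
... | yes refl = contradiction c∈ (∉-remove D w)
... | no c≢w   = subst T (lookup∘update′ c≢w D false) c∈

insert-remove : ∀ (D : Subset n) w → w ∈ˢ D → (D [ w ]≔ false) [ w ]≔ true ≡ D
insert-remove D w w∈D = trans ([]≔-idempotent D w)
  (trans (cong (D [ w ]≔_) (sym (to T-≡ w∈D))) ([]≔-lookup D w))

∣insert∣ : ∀ (D : Subset n) w → w ∉ˢ D → ∣ D [ w ]≔ true ∣ ≡ suc ∣ D ∣
∣insert∣ (false ∷ D) zero    w∉D = refl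
∣insert∣ (true ∷ D)  zero    w∉D = contradiction tt w∉D
∣insert∣ (true ∷ D)  (suc w) w∉D = cong suc (∣insert∣ D w w∉D)
∣insert∣ (false ∷ D) (suc w) w∉D = ∣insert∣ D w w∉D

∣remove∣ : ∀ (D : Subset n) w → w ∈ˢ D → ∣ D ∣ ≡ suc ∣ D [ w ]≔ false ∣
∣remove∣ D w w∈D = trans (cong ∣_∣ (sym (insert-remove D w w∈D)))
                         (∣insert∣ (D [ w ]≔ false) w (∉-remove D w))

∈⊤ : ∀ (c : Fin n) → c ∈ˢ ⊤
∈⊤ c = from T-≡ (lookup-replicate c true)

-- The game on clusters

-- S contains the component of w in G − D; allowing a larger set avoids computing components.
record Isolates (G : SimpleGraph n) (D S : Subset n) (u w : Fin n) : Set where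
  constructor isolates
  field
    u-adj-w : T (adj G u w)
    w∈S     : w ∈ˢ S
    closed  : ∀ c d → c ∈ˢ S → d ∉ˢ D → T (adj G c d) → d ∈ˢ S
    only-w  : ∀ c → c ∈ˢ S → c ∉ˢ D → T (adj G u c) → c ≡ w

-- D is the set of entirely blue clusters: [outer] is a force by
-- an All cluster of a None cluster, [leaf] a force by a One cluster u together with the backforce
-- in u that follows.  ℓ counts the One clusters that are needed.
data Clears (G : SimpleGraph n) : Subset n → ℕ → Set where
  full  : ∀ {D} → (∀ c → c ∈ˢ D) → Clears G D 0
  outer : ∀ {D ℓ} u w S → u ∈ˢ D → w ∉ˢ D → Isolates G D S u w →
          Clears G (D [ w ]≔ true) ℓ → Clears G D ℓ
  leaf  : ∀ {D ℓ} u w → u ∉ˢ D → w ∉ˢ D → T (adj G u w) →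
          (∀ c → c ∉ˢ D → T (adj G u c) → c ≡ w) →
          Clears G ((D [ w ]≔ true) [ u ]≔ true) ℓ → Clears G D (suc ℓ)

adj⇒≢ : (G : SimpleGraph n) → ∀ {u w} → T (adj G u w) → u ≢ w
adj⇒≢ G {u} uw refl = subst T (adj-irrefl G u) uw

T-adj-sym : (G : SimpleGraph n) → ∀ {u w} → T (adj G u w) → T (adj G w u)
T-adj-sym G {u} {w} = subst T (adj-sym G u w)

∣leaf∣ : (D : Subset n) → ∀ {u w} → u ≢ w → u ∉ˢ D → w ∉ˢ D →
         ∣ (D [ w ]≔ true) [ u ]≔ true ∣ ≡ suc (suc ∣ D ∣)
∣leaf∣ D {u} {w} u≢w u∉D w∉D =
  trans (∣insert∣ (D [ w ]≔ true) u (u∉D ∘ ∈-insert⁻ D w u≢w)) (cong suc (∣insert∣ D w w∉D))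

-- A `leaf` move counts one in `ℓ` and puts two new clusters into `D`, an `outer` move puts one
-- there, and `D` never has more than `n` clusters.
Clears⇒ℓ-bound : (G : SimpleGraph n) → ∀ {D ℓ} → Clears G D ℓ → ℓ + ℓ + ∣ D ∣ ≤ n
Clears⇒ℓ-bound G {D} (full _) = ∣p∣≤n D
Clears⇒ℓ-bound G {D} {ℓ} (outer u w S u∈ w∉ _ rest) =
  ≤-trans (+-monoʳ-≤ (ℓ + ℓ) (≤-trans (n≤1+n _) (≤-reflexive (sym (∣insert∣ D w w∉)))))
          (Clears⇒ℓ-bound G rest)
Clears⇒ℓ-bound G {D} {suc ℓ} (leaf u w u∉ w∉ uw _ rest) =
  ≤-trans (≤-reflexive (trans
      (solve 2 (λ l d → con 1 :+ l :+ (con 1 :+ l) :+ d := l :+ l :+ (con 2 :+ d)) refl ℓ ∣ D ∣)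
      (cong (ℓ + ℓ +_) (sym (∣leaf∣ D (adj⇒≢ G uw) u∉ w∉)))))
    (Clears⇒ℓ-bound G rest)

Clears⇒ℓ<n : (G : SimpleGraph n) → ∀ {D ℓ} → 0 < n → Clears G D ℓ → ℓ < n
Clears⇒ℓ<n G {D} {zero}  0<n _  = 0<n
Clears⇒ℓ<n G {D} {suc ℓ} _   cl = ≤-trans
  (s≤s (≤-trans (m≤n+m (suc ℓ) ℓ) (m≤m+n _ ∣ D ∣))) (Clears⇒ℓ-bound G cl)

-- Deciding the game and minimising its cost

infixr 2 _×-dec′_
-- The second decision may use the proof of the first. In the search this supplies `w ∉ˢ D`, from
-- which the move is known to enlarge `D`.
_×-dec′_ : {P Q : Set} → Dec P → (P → Dec Q) → Dec (P × Q)
no ¬p ×-dec′ q? = no (¬p ∘ proj₁)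
yes p ×-dec′ q? = map′ (p ,_) proj₂ (q? p)

_→-dec′_ : {P Q : Set} → Dec P → Dec Q → Dec (P → Q)
yes p →-dec′ q? = map′ (λ q _ → q) (λ f → f p) q?
no ¬p →-dec′ q? = yes λ p → contradiction p ¬p

Isolates? : (G : SimpleGraph n) → ∀ D S u w → Dec (Isolates G D S u w)
Isolates? G D S u w = map′ (λ (a , b , c , d) → isolates a b c d) (λ (isolates a b c d) → a , b , c , d)
  (T? _ ×-dec T? _
   ×-dec (all? λ c → all? λ d → T? _ →-dec′ (¬? (T? _) →-dec′ (T? _ →-dec′ T? _)))
   ×-dec (all? λ c → T? _ →-dec′ (¬? (T? _) →-dec′ (T? _ →-dec′ (c ≟ w)))))

Outer : (G : SimpleGraph n) → Subset n → ℕ → Set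
Outer G D ℓ = ∃ λ u → ∃ λ w → (u ∈ˢ D × w ∉ˢ D × ∃ λ S → Isolates G D S u w) ×
              Clears G (D [ w ]≔ true) ℓ

Leaf : (G : SimpleGraph n) → Subset n → ℕ → Set
Leaf G D ℓ = ∃ λ u → ∃ λ w →
             (u ∉ˢ D × w ∉ˢ D × T (adj G u w) × (∀ c → c ∉ˢ D → T (adj G u c) → c ≡ w)) ×
             ∃ λ ℓ′ → ℓ ≡ suc ℓ′ × Clears G ((D [ w ]≔ true) [ u ]≔ true) ℓ′

Clears-unfold : (G : SimpleGraph n) → ∀ {D ℓ} →
                Clears G D ℓ → ((∀ c → c ∈ˢ D) × ℓ ≡ 0) ⊎ Outer G D ℓ ⊎ Leaf G D ℓ
Clears-unfold G (full all∈)                 = inj₁ (all∈ , refl)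
Clears-unfold G (outer u w S u∈ w∉ iso cl)  = inj₂ (inj₁ (u , w , (u∈ , w∉ , S , iso) , cl))
Clears-unfold G (leaf u w u∉ w∉ uw only cl) = inj₂ (inj₂ (u , w , (u∉ , w∉ , uw , only) , _ , refl , cl))

Clears-fold : (G : SimpleGraph n) → ∀ {D ℓ} →
              ((∀ c → c ∈ˢ D) × ℓ ≡ 0) ⊎ Outer G D ℓ ⊎ Leaf G D ℓ → Clears G D ℓ
Clears-fold G (inj₁ (all∈ , refl)) = full all∈
Clears-fold G (inj₂ (inj₁ (u , w , (u∈ , w∉ , S , iso) , cl))) = outer u w S u∈ w∉ iso cl
Clears-fold G (inj₂ (inj₂ (u , w , (u∉ , w∉ , uw , only) , _ , refl , cl))) = leaf u w u∉ w∉ uw only cl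

-- The fuel `m` bounds the number of clusters outside `D`. Every move enlarges `D`, so one unit can
-- be spent per move.
Clears?-fuel : (G : SimpleGraph n) → ∀ m D ℓ → n ≤ m + ∣ D ∣ → Dec (Clears G D ℓ)
larger? : (G : SimpleGraph n) → ∀ m (D D′ : Subset n) ℓ → n ≤ m + ∣ D ∣ → ∣ D ∣ < ∣ D′ ∣ → Dec (Clears G D′ ℓ)

larger? G zero    D D′ ℓ n≤ D<D′ = contradiction (≤-trans D<D′ (∣p∣≤n D′)) (≤⇒≯ n≤)
larger? G (suc m) D D′ ℓ n≤ D<D′ = Clears?-fuel G m D′ ℓ
  (≤-trans n≤ (≤-trans (≤-reflexive (sym (+-suc m ∣ D ∣))) (+-monoʳ-≤ m D<D′)))

Clears?-fuel G m D ℓ n≤ = map′ (Clears-fold G) (Clears-unfold G)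
  (((all? λ c → T? _) ×-dec (ℓ ≟ℕ 0))
   ⊎-dec (any? λ u → any? λ w →
     (T? _ ×-dec ¬? (T? _) ×-dec anySubset? (λ S → Isolates? G D S u w))
     ×-dec′ λ (_ , w∉ , _) → larger? G m D _ ℓ n≤ (≤-reflexive (sym (∣insert∣ D w w∉))))
   ⊎-dec (any? λ u → any? λ w →
     (¬? (T? _) ×-dec ¬? (T? _) ×-dec T? _ ×-dec (all? λ c → ¬? (T? _) →-dec′ (T? _ →-dec′ (c ≟ w))))
     ×-dec′ λ (u∉ , w∉ , uw , _) → pred-step ℓ λ ℓ′ → larger? G m D _ ℓ′ n≤
       (≤-trans (n≤1+n _) (≤-reflexive (sym (∣leaf∣ D (adj⇒≢ G uw) u∉ w∉))))))
  where
  pred-step : {P : ℕ → Set} → ∀ k → (∀ k′ → Dec (P k′)) → Dec (∃ λ k′ → k ≡ suc k′ × P k′)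
  pred-step zero    P? = no λ ()
  pred-step (suc k) P? = map′ (λ p → k , refl , p) (λ { (_ , refl , p) → p }) (P? k)

Clears? : (G : SimpleGraph n) → ∀ D ℓ → Dec (Clears G D ℓ)
Clears? {n} G D ℓ = Clears?-fuel G n D ℓ (m≤m+n n ∣ D ∣)

least : {P : ℕ → Set} → (∀ k → Dec (P k)) → ∀ k → P k → ∃ λ m → P m × (∀ j → P j → m ≤ j)
least P? zero    p = zero , p , λ _ _ → z≤n
least {P} P? (suc k) p with P? 0
... | yes p₀ = zero , p₀ , λ _ _ → z≤n
... | no ¬p₀ with least (P? ∘ suc) k p
...   | m , pm , min = suc m , pm , λ { zero p₀ → contradiction p₀ ¬p₀ ; (suc j) pj → s≤s (min j pj) }

-- The search runs over the total cost `k`, which together with `D` determines `ℓ` as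
-- `k ∸ r * ∣ D ∣`. It ends because starting with all clusters blue always wins.
optimal : (G : SimpleGraph n) → ∀ r → ∃ λ D → ∃ λ ℓ → Clears G D ℓ ×
          (∀ D′ ℓ′ → Clears G D′ ℓ′ → r * ∣ D ∣ + ℓ ≤ r * ∣ D′ ∣ + ℓ′)
optimal {n} G r
  with least Cost? _ (to-cost (full {D = ⊤} ∈⊤))
  where
  Cost : ℕ → Set
  Cost k = ∃ λ D → r * ∣ D ∣ ≤ k × Clears G D (k ∸ r * ∣ D ∣)
  Cost? : ∀ k → Dec (Cost k)
  Cost? k = anySubset? λ D → (r * ∣ D ∣ ≤? k) ×-dec Clears? G D (k ∸ r * ∣ D ∣)
  to-cost : ∀ {D ℓ} → Clears G D ℓ → Cost (r * ∣ D ∣ + ℓ)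
  to-cost {D} {ℓ} cl = D , m≤m+n _ ℓ , subst (Clears G D) (sym (m+n∸m≡n (r * ∣ D ∣) ℓ)) cl
... | k , (D , le , cl) , min = D , k ∸ r * ∣ D ∣ , cl , λ D′ ℓ′ cl′ →
  subst (_≤ r * ∣ D′ ∣ + ℓ′) (sym (m+[n∸m]≡n le)) (min _ (D′ , m≤m+n _ ℓ′ ,
    subst (Clears G D′) (sym (m+n∸m≡n (r * ∣ D′ ∣) ℓ′)) cl′))

-- From the blowup to the game on clusters

¬¬-∀ : {P : Fin n → Set} → (∀ c → ¬ ¬ P c) → ¬ ¬ (∀ c → P c)
¬¬-∀ = sequence (RawMonad.rawApplicative ¬¬-Monad)

-- Excluded middle holds under double negation for each `c`, and double negation commutes with a
-- finite universal quantifier. The application is to connectivity among white vertices.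
decide-classically : (P : Fin n → Set) → ¬ ¬ (Σ (Subset n) λ S → ∀ c → c ∈ˢ S ⇔ P c)
decide-classically {n} P ¬S = ¬¬-∀ (λ c → ¬¬-excluded-middle) λ P? →
  ¬S (tabulate (isYes ∘ P?) , λ c →
    mk⇔ (λ t → toWitness {a? = P? c} (subst T (lookup∘tabulate (isYes ∘ P?) c) t))
        (λ p → subst T (sym (lookup∘tabulate (isYes ∘ P?) c)) (fromWitness {a? = P? c} p)))

_∪_ : (Fin n → Bool) → (Fin n → Bool) → Fin n → Bool
(F ∪ W) c = F c ∨ W c

❴_❵ : Fin n → Fin n → Bool
❴ w ❵ c = isYes (c ≟ w)

∈❴❵⇒≡ : ∀ {w c : Fin n} → T (❴ w ❵ c) → c ≡ w
∈❴❵⇒≡ {w = w} {c} = toWitness {a? = c ≟ w}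

∈❴❵ : ∀ (w : Fin n) → T (❴ w ❵ w)
∈❴❵ w = fromWitness {a? = w ≟ w} refl

-- Turns a forcing process of the blowup into one of the game on clusters, while maintaining
-- ρ |D| + e ℓ ≤ C + Σ_{c ∈ F} wt c.  With wt c the number of white vertices of R_c and
-- ρ = r, e = 1 this bounds r |D| + ℓ by the number of blue vertices; with wt = ρ = 1 and e = 0 it bounds
-- |D| by the number of All clusters if one cluster is forced at a time.
module Extraction {n r} (G : SimpleGraph n) (B₀ : Vtx G r → Bool)
  (wt : Fin n → ℕ) (ρ e C : ℕ) (R : State G r → State G r → Set₁)
  (R⇒Step : ∀ {s s′} → R s s′ → Step G r s s′)
  (wt≤ρ : ∀ c → wt c ≤ ρ)
  -- A cluster with a blue vertex leaves room `e` below `ρ`; this pays for its use as a One cluster.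
  (wt-partial : ∀ c i → T (B₀ (c , i)) → wt c + e ≤ ρ)
  (total : ρ * n ≤ C + ∑ wt)
  -- Only clusters still in their initial colouring are counted, so `wt` may refer to `B₀` late in
  -- the process.
  (forced-≤ : ∀ {B l B′ l′} → R (B , l) (B′ , l′) → (W : Fin n → Bool) →
     (∀ c → T (W c) → ClusterForced G r B B′ c × (∀ i → B (c , i) ⇔ T (B₀ (c , i)))) →
     ∑ (λ c → if W c then wt c else 0) ≤ ρ)
  where

  weight : (Fin n → Bool) → ℕ
  weight F = ∑ (λ c → if F c then wt c else 0)

  weight-∪ : ∀ F W → weight (F ∪ W) ≤ weight F + weight W
  weight-∪ F W = ≤-trans (∑-mono pointwise) (≤-reflexive (∑-+ (λ c → if F c then wt c else 0) _))
    where
    pointwise : ∀ c → (if (F ∪ W) c then wt c else 0) ≤ (if F c then wt c else 0) + (if W c then wt c else 0)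
    pointwise c with F c
    ... | true  = m≤m+n _ _
    ... | false = ≤-refl

  weight-❴❵ : ∀ w → weight ❴ w ❵ ≡ wt w
  weight-❴❵ w = trans
    (∑-single _ w λ c c≢w → if-false {b = ❴ w ❵ c} (c≢w ∘ ∈❴❵⇒≡))
    (if-true {b = ❴ w ❵ w} (∈❴❵ w))

  -- F is the set of clusters already accounted for; outside F nothing has happened yet.
  record Invariant (F : Fin n → Bool) (s : State G r) : Set where
    field
      same  : ∀ c → ¬ T (F c) → ∀ i → proj₁ s (c , i) ⇔ T (B₀ (c , i))
      white : ∀ c → ¬ T (F c) → ∃ λ i → ¬ T (B₀ (c , i))
      last∈ : ∀ u → proj₂ s ≡ just u → T (F (proj₁ u))

  -- Established backwards from the end of the process. Clusters of `D` outside `F` are those that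
  -- the process forces later but the game takes as All from the start.
  Goal : (Fin n → Bool) → Set
  Goal F = ∃ λ D → ∃ λ ℓ → (∀ c → T (F c) → c ∈ˢ D) × Clears G D ℓ × ρ * ∣ D ∣ + e * ℓ ≤ C + weight F

  goal-all : ∀ F → (∀ c → T (F c)) → Goal F
  goal-all F all∈ = ⊤ , 0 , (λ c _ → ∈⊤ c) , full ∈⊤ , (begin
    ρ * ∣ ⊤ {n} ∣ + e * 0 ≡⟨ cong₂ _+_ (cong (ρ *_) (∣⊤∣≡n n)) (*-zeroʳ e) ⟩
    ρ * n + 0             ≡⟨ +-identityʳ _ ⟩
    ρ * n                 ≤⟨ total ⟩
    C + ∑ wt              ≡⟨ cong (C +_) (∑-cong λ c → if-true {b = F c} (all∈ c)) ⟨
    C + weight F          ∎)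
    where open ≤-Reasoning

  -- One `outer` move leads from `F` to `F′`. Among the new clusters only `w` is forced in the game;
  -- the others stay in `D`. Taking `w` out of `D′` saves `ρ`, which covers the growth of the
  -- weight.
  goal-outer : ∀ F F′ u w S → (∀ c → T (F c) → T (F′ c)) → weight F′ ≤ weight F + ρ →
               T (F u) → T (F′ w) → ¬ T (F w) →
               (∀ D → (∀ c → T (F c) → c ∈ˢ D) → (∀ c → T (F′ c) → c ≢ w → c ∈ˢ D) → Isolates G D S u w) →
               Goal F′ → Goal F
  goal-outer F F′ u w S F⊆F′ bound u∈F w∈F′ w∉F iso (D′ , ℓ , F′⊆D′ , cl , cost) =
    D , ℓ , F⊆D ,
    outer u w S (F⊆D u u∈F) (∉-remove D′ w) (iso D F⊆D λ c c∈F′ c≢w → ∈-remove⁺ D′ w c≢w (F′⊆D′ c c∈F′))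
      (subst (λ X → Clears G X ℓ) (sym (insert-remove D′ w (F′⊆D′ w w∈F′))) cl) ,
    +-cancelʳ-≤ ρ _ _ (begin
      ρ * ∣ D ∣ + e * ℓ + ρ
        ≡⟨ solve 3 (λ p d x → p :* d :+ x :+ p := p :* (con 1 :+ d) :+ x) refl ρ ∣ D ∣ (e * ℓ) ⟩
      ρ * suc ∣ D ∣ + e * ℓ  ≡⟨ cong (λ k → ρ * k + e * ℓ) (∣remove∣ D′ w (F′⊆D′ w w∈F′)) ⟨
      ρ * ∣ D′ ∣ + e * ℓ     ≤⟨ cost ⟩
      C + weight F′          ≤⟨ +-monoʳ-≤ C bound ⟩
      C + (weight F + ρ)     ≡⟨ +-assoc C _ ρ ⟨
      C + weight F + ρ       ∎)
    where
    open ≤-Reasoning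
    D = D′ [ w ]≔ false
    F⊆D : ∀ c → T (F c) → c ∈ˢ D
    F⊆D c c∈F = ∈-remove⁺ D′ w (λ { refl → w∉F c∈F }) (F′⊆D′ c (F⊆F′ c c∈F))

  -- Taking both `u` and `w` out of `D′` saves `ρ + ρ`: one `ρ` for the forced clusters, the other
  -- for the weight of `u` and the charge `e` for a further One cluster.
  goal-leaf : ∀ F F′ u w → (∀ c → T (F c) → T (F′ c)) → weight F′ + e ≤ weight F + (ρ + ρ) →
              T (F′ u) → ¬ T (F u) → T (F′ w) → ¬ T (F w) → T (adj G u w) →
              (∀ c → ¬ T (F c) → T (adj G u c) → T (F′ c)) →
              Goal F′ → Goal F
  goal-leaf F F′ u w F⊆F′ bound u∈F′ u∉F w∈F′ w∉F uw nbrs∈F′ (D′ , ℓ , F′⊆D′ , cl , cost) =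
    D , suc ℓ , F⊆D ,
    leaf u w (∉-remove D′ u ∘ ∈-remove⁻ D₁ w) (∉-remove D₁ w) uw only
      (subst (λ X → Clears G X ℓ) (sym D′≡) cl) ,
    +-cancelʳ-≤ (ρ + ρ) _ _ (begin
      ρ * ∣ D ∣ + e * suc ℓ + (ρ + ρ)
        ≡⟨ solve 4 (λ p d x l → p :* d :+ x :* (con 1 :+ l) :+ (p :+ p) := p :* (con 2 :+ d) :+ x :* l :+ x)
             refl ρ ∣ D ∣ e ℓ ⟩
      ρ * suc (suc ∣ D ∣) + e * ℓ + e
        ≡⟨ cong (λ k → ρ * k + e * ℓ + e) (trans (∣remove∣ D′ u (F′⊆D′ u u∈F′)) (cong suc (∣remove∣ D₁ w w∈D₁))) ⟨
      ρ * ∣ D′ ∣ + e * ℓ + e     ≤⟨ +-monoˡ-≤ e cost ⟩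
      C + weight F′ + e          ≡⟨ +-assoc C _ e ⟩
      C + (weight F′ + e)        ≤⟨ +-monoʳ-≤ C bound ⟩
      C + (weight F + (ρ + ρ))   ≡⟨ +-assoc C _ (ρ + ρ) ⟨
      C + weight F + (ρ + ρ)     ∎)
    where
    open ≤-Reasoning
    D₁ = D′ [ u ]≔ false
    D = D₁ [ w ]≔ false
    w∈D₁ : w ∈ˢ D₁
    w∈D₁ = ∈-remove⁺ D′ u (adj⇒≢ G uw ∘ sym) (F′⊆D′ w w∈F′)
    D′≡ : (D [ w ]≔ true) [ u ]≔ true ≡ D′
    D′≡ = trans (cong (_[ u ]≔ true) (insert-remove D₁ w w∈D₁)) (insert-remove D′ u (F′⊆D′ u u∈F′))
    F⊆D : ∀ c → T (F c) → c ∈ˢ D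
    F⊆D c c∈F = ∈-remove⁺ D₁ w (λ { refl → w∉F c∈F })
      (∈-remove⁺ D′ u (λ { refl → u∉F c∈F }) (F′⊆D′ c (F⊆F′ c c∈F)))
    only : ∀ c → c ∉ˢ D → T (adj G u c) → c ≡ w
    only c c∉D uc = decidable-stable (c ≟ w) λ c≢w → c∉D (∈-remove⁺ D₁ w c≢w
      (∈-remove⁺ D′ u (adj⇒≢ G uc ∘ sym)
        (F′⊆D′ c (decidable-stable (T? (F′ c)) λ c∉F′ → c∉F′ (nbrs∈F′ c (λ c∈F → c∉F′ (F⊆F′ c c∈F)) uc)))))

  module Force {B last B′} (F : Fin n → Bool) (inv : Invariant F (B , last)) (u x : Vtx G r)
    (step : R (B , last) (B′ , just u)) (u-blue : B u)
    (hit : ∃ λ v → NbrIn G r B u x v) (B′⇔ : ∀ v → B′ v ⇔ (B v ⊎ NbrIn G r B u x v))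
    (S : Subset n) (S⇔ : ∀ c → c ∈ˢ S ⇔ ∃ λ i → ¬ B (c , i) × Conn G r B x (c , i))
    (continue : ∀ F′ → Invariant F′ (B′ , just u) → ¬ ¬ Goal F′)
    where
    open Invariant inv

    û : Fin n
    û = proj₁ u

    -- The unaccounted clusters that this force hits.
    W : Fin n → Bool
    W c = not (F c) ∧ (adj G û c ∧ lookup S c)

    ∈W⁻ : ∀ {c} → T (W c) → ¬ T (F c) × T (adj G û c) × c ∈ˢ S
    ∈W⁻ t = let (a , b) = to T-∧ t ; (b , c) = to T-∧ b in T-not⁻ a , b , c

    ∈W : ∀ {c} → ¬ T (F c) → T (adj G û c) → c ∈ˢ S → T (W c)
    ∈W a b c = from T-∧ (T-not a , from T-∧ (b , c))

    white-in-B : ∀ {c} → ¬ T (F c) → ∃ λ i → ¬ B (c , i)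
    white-in-B {c} c∉F = let (i , ¬b) = white c c∉F in i , λ b → ¬b (to (same c c∉F i) b)

    weight-W : weight W ≤ ρ
    weight-W = forced-≤ step W λ c c∈W →
      let (c∉F , uc , c∈S) = ∈W⁻ c∈W ; (i , ¬b , x~c) = to (S⇔ c) c∈S
      in (i , ¬b , from (B′⇔ _) (inj₂ (uc , ¬b , x~c))) , same c c∉F

    invariant : ∀ F′ → (∀ c → T (F c) → T (F′ c)) → (∀ c → T (W c) → T (F′ c)) → T (F′ û) →
                Invariant F′ (B′ , just u)
    invariant F′ F⊆F′ W⊆F′ û∈F′ = record
      { same = λ c c∉F′ i → let c∉F = c∉F′ ∘ F⊆F′ c in mk⇔
          (λ b′ → [ to (same c c∉F i)
                  , (λ (uc , ¬b , x~c) → contradiction (W⊆F′ c (∈W c∉F uc (from (S⇔ c) (i , ¬b , x~c)))) c∉F′)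
                  ]′ (to (B′⇔ _) b′))
          (λ b₀ → from (B′⇔ _) (inj₁ (from (same c c∉F i) b₀)))
      ; white = λ c c∉F′ → white c (c∉F′ ∘ F⊆F′ c)
      ; last∈ = λ { _ refl → û∈F′ }
      }

    -- A cluster outside `D` is outside `F`, so it keeps a white vertex, by which the walk from `x`
    -- can be extended.
    S-closed : ∀ D → (∀ c → T (F c) → c ∈ˢ D) → ∀ c d → c ∈ˢ S → d ∉ˢ D → T (adj G c d) → d ∈ˢ S
    S-closed D F⊆D c d c∈S d∉D cd =
      let (i , _ , x~c) = to (S⇔ c) c∈S ; (j , ¬b) = white-in-B (d∉D ∘ F⊆D d)
      in from (S⇔ d) (j , ¬b , there x~c ¬b cd)

    -- A force by a vertex of an unaccounted cluster reaches all of its white neighbours, since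
    -- its component contains a white vertex of that very cluster.
    nbr∈S : ¬ T (F û) → ∀ {c} → ¬ T (F c) → T (adj G û c) → c ∈ˢ S
    nbr∈S û∉F {c} c∉F uc =
      let (v , uv , ¬bv , x~v) = hit ; (k , ¬bk) = white-in-B û∉F ; (j , ¬bj) = white-in-B c∉F
      in from (S⇔ c) (j , ¬bj , there (there x~v ¬bk (T-adj-sym G uv)) ¬bj uc)

    ⊆∪ˡ : ∀ (X Y : Fin n → Bool) c → T (X c) → T ((X ∪ Y) c)
    ⊆∪ˡ X Y c t = from T-∨ (inj₁ t)

    ⊆∪ʳ : ∀ (X Y : Fin n → Bool) c → T (Y c) → T ((X ∪ Y) c)
    ⊆∪ʳ X Y c t = from (T-∨ {X c}) (inj₂ t)

    goal : ¬ ¬ Goal F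
    goal with T? (F û) | any? (λ w → T? (W w))
    -- Only accounted clusters are touched: no move in the game.
    ... | yes û∈F | no W-empty = continue F
      (invariant F (λ _ t → t) (λ c t → contradiction (c , t) W-empty) û∈F)
    -- One cluster `w` of `W` is forced in the game, and the rest of `W` starts as All.
    ... | yes û∈F | yes (w , w∈W) = ¬¬-map
      (goal-outer F F′ û w S (⊆∪ˡ F W) (≤-trans (weight-∪ F W) (+-monoʳ-≤ _ weight-W))
        û∈F (⊆∪ʳ F W w w∈W) w∉F λ D F⊆D F′∖w⊆D → isolates uw w∈S (S-closed D F⊆D)
          λ c c∈S c∉D uc → decidable-stable (c ≟ w) λ c≢w →
            c∉D (F′∖w⊆D c (⊆∪ʳ F W c (∈W (c∉D ∘ F⊆D c) uc c∈S)) c≢w))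
      (continue F′ (invariant F′ (⊆∪ˡ F W) (⊆∪ʳ F W) (⊆∪ˡ F W û û∈F)))
      where
      F′ = F ∪ W
      w∉F = proj₁ (∈W⁻ w∈W)
      uw = proj₁ (proj₂ (∈W⁻ w∈W))
      w∈S = proj₂ (proj₂ (∈W⁻ w∈W))
    -- The forcing vertex was blue from the start, so `û` can serve as a One cluster. By `nbr∈S` its
    -- unaccounted neighbours all lie in `W`. It is accounted at once, whether or not the process
    -- backforces it.
    ... | no û∉F | yes (w , w∈W) = ¬¬-map
      (goal-leaf F F′ û w F⊆F′ bound û∈F′ û∉F (W⊆F′ w w∈W) (proj₁ (∈W⁻ w∈W)) (proj₁ (proj₂ (∈W⁻ w∈W)))
        λ c c∉F uc → W⊆F′ c (∈W c∉F uc (nbr∈S û∉F c∉F uc)))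
      (continue F′ (invariant F′ F⊆F′ W⊆F′ û∈F′))
      where
      open ≤-Reasoning
      F′ = (F ∪ W) ∪ ❴ û ❵
      F⊆F′ : ∀ c → T (F c) → T (F′ c)
      F⊆F′ c t = ⊆∪ˡ (F ∪ W) ❴ û ❵ c (⊆∪ˡ F W c t)
      W⊆F′ : ∀ c → T (W c) → T (F′ c)
      W⊆F′ c t = ⊆∪ˡ (F ∪ W) ❴ û ❵ c (⊆∪ʳ F W c t)
      û∈F′ = ⊆∪ʳ (F ∪ W) ❴ û ❵ û (∈❴❵ û)
      bound : weight F′ + e ≤ weight F + (ρ + ρ)
      bound = begin
        weight F′ + e                          ≤⟨ +-monoˡ-≤ e (weight-∪ (F ∪ W) ❴ û ❵) ⟩
        weight (F ∪ W) + weight ❴ û ❵ + e      ≡⟨ cong (λ k → weight (F ∪ W) + k + e) (weight-❴❵ û) ⟩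
        weight (F ∪ W) + wt û + e              ≡⟨ +-assoc _ (wt û) e ⟩
        weight (F ∪ W) + (wt û + e)
          ≤⟨ +-mono-≤ (weight-∪ F W) (wt-partial û _ (to (same û û∉F _) u-blue)) ⟩
        weight F + weight W + ρ                ≡⟨ +-assoc _ (weight W) ρ ⟩
        weight F + (weight W + ρ)              ≤⟨ +-monoʳ-≤ (weight F) (+-monoˡ-≤ ρ weight-W) ⟩
        weight F + (ρ + ρ)                     ∎
    ... | no û∉F | no W-empty with proj₁ (proj₁ hit) in eq
    -- û has only accounted neighbours, at least one of them, so it can be added for free.
    ...   | c = ¬¬-map
      (goal-outer F F′ c û (⊥ [ û ]≔ true) (⊆∪ˡ F ❴ û ❵)
        (≤-trans (weight-∪ F ❴ û ❵) (+-monoʳ-≤ _ (≤-trans (≤-reflexive (weight-❴❵ û)) (wt≤ρ û))))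
        c∈F û∈F′ û∉F λ D F⊆D _ → isolates (T-adj-sym G uc) (∈-insert ⊥ û)
          (λ a d a∈ d∉D ad → contradiction
            (subst (λ z → T (adj G z d)) (∈-⊥ a∈) ad) (no-nbr d (d∉D ∘ F⊆D d)))
          λ a a∈ _ _ → ∈-⊥ a∈)
      (continue F′ (invariant F′ (⊆∪ˡ F ❴ û ❵) (λ a t → contradiction (a , t) W-empty) û∈F′))
      where
      F′ = F ∪ ❴ û ❵
      û∈F′ = ⊆∪ʳ F ❴ û ❵ û (∈❴❵ û)
      no-nbr : ∀ d → ¬ T (F d) → ¬ T (adj G û d)
      no-nbr d d∉F ud = W-empty (d , ∈W d∉F ud (nbr∈S û∉F d∉F ud))
      uc : T (adj G û c)
      uc = subst (λ z → T (adj G û z)) eq (proj₁ (proj₂ hit))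
      c∈F : T (F c)
      c∈F = decidable-stable (T? (F c)) λ c∉F → no-nbr c c∉F uc
      ∈-⊥ : ∀ {a} → a ∈ˢ (⊥ [ û ]≔ true) → a ≡ û
      ∈-⊥ {a} a∈ = decidable-stable (a ≟ û) λ a≢û →
        subst T (lookup-replicate a false) (∈-insert⁻ ⊥ û a≢û a∈)

  extract : ∀ {s t} → Star R s t → (∀ v → proj₁ t v) → ∀ F → Invariant F s → ¬ ¬ Goal F
  extract ε all-blue F inv = contradiction (goal-all F λ c →
    decidable-stable (T? (F c)) λ c∉F →
      let (i , ¬b) = white c c∉F in ¬b (to (same c c∉F i) (all-blue _)))
    where open Invariant inv
  extract (step ◅ steps) all-blue F inv with R⇒Step step
  ... | force {B} u x u-blue _ _ hit B′⇔ = λ ¬goal →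
    decide-classically (λ c → ∃ λ i → ¬ B (c , i) × Conn G r B x (c , i)) λ (S , S⇔) →
      Force.goal F inv u x step u-blue hit B′⇔ S S⇔ (extract steps all-blue) ¬goal
  -- By `last∈` the backforced cluster is already accounted, so `F` stays the same.
  ... | back u _ B′⇔ = extract steps all-blue F record
    { same  = λ c c∉F i → mk⇔
        (λ b′ → [ to (same c c∉F i) , (λ { refl → contradiction (last∈ u refl) c∉F }) ]′ (to (B′⇔ _) b′))
        (λ b₀ → from (B′⇔ _) (inj₁ (from (same c c∉F i) b₀)))
    ; white = white
    ; last∈ = λ _ ()
    }
    where open Invariant inv

-- The two weightings of the extraction

∑-if-≤ : {W : Fin n → Bool} {wt : Fin n → ℕ} {ρ : ℕ} → (∀ c → wt c ≤ ρ) →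
         (∀ c d → T (W c) → T (W d) → c ≡ d) → ∑ (λ c → if W c then wt c else 0) ≤ ρ
∑-if-≤ {W = W} {wt} wt≤ρ subsingleton with any? (λ c → T? (W c))
... | no empty = ≤-trans (≤-reflexive (∑-zero _ λ c → if-false {b = W c} λ t → empty (c , t))) z≤n
... | yes (w , w∈W) = ≤-trans
  (≤-reflexive (trans (∑-single _ w λ c c≢w → if-false {b = W c} λ t → c≢w (subsingleton c w t w∈W))
                      (if-true {b = W w} w∈W)))
  (wt≤ρ w)

T-all : (p : Fin r → Bool) → T (all p (allFin r)) ⇔ (∀ i → T (p i))
T-all {r} p = mk⇔ (λ t i → all⁻ (allFin r) t (∈-allFin i)) (λ p∀ → all⁺ (allFin r) p∀)
  where
  all⁻ : ∀ xs → T (all p xs) → ∀ {i} → i ∈ xs → T (p i)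
  all⁻ (x ∷ xs) t (here refl) = proj₁ (to T-∧ t)
  all⁻ (x ∷ xs) t (there i∈)  = all⁻ xs (proj₂ (to (T-∧ {p x}) t)) i∈
  all⁺ : ∀ xs → (∀ i → T (p i)) → T (all p xs)
  all⁺ []       p∀ = tt
  all⁺ (x ∷ xs) p∀ = from T-∧ (p∀ x , all⁺ xs p∀)

⟦⟧+⟦not⟧ : ∀ b → ⟦ b ⟧ + ⟦ not b ⟧ ≡ 1
⟦⟧+⟦not⟧ true  = refl
⟦⟧+⟦not⟧ false = refl

module _ (G : SimpleGraph n) (B₀ : Vtx G r → Bool) where

  blues whites : Fin n → ℕ
  blues c  = ∑ λ i → ⟦ B₀ (c , i) ⟧
  whites c = ∑ λ i → ⟦ not (B₀ (c , i)) ⟧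

  blues+whites : ∀ c → blues c + whites c ≡ r
  blues+whites c = begin
    blues c + whites c                              ≡⟨ ∑-+ (λ i → ⟦ B₀ (c , i) ⟧) _ ⟨
    ∑ (λ i → ⟦ B₀ (c , i) ⟧ + ⟦ not (B₀ (c , i)) ⟧) ≡⟨ ∑-cong (λ i → ⟦⟧+⟦not⟧ (B₀ (c , i))) ⟩
    ∑ {r} (λ i → 1)                                 ≡⟨ ∑-const r 1 ⟩
    r * 1                                           ≡⟨ *-identityʳ r ⟩
    r                                               ∎
    where open ≡-Reasoning

  whites≤r : ∀ c → whites c ≤ r
  whites≤r c = ≤-trans (m≤n+m (whites c) (blues c)) (≤-reflexive (blues+whites c))

  blues-all : ∀ c → (∀ i → T (B₀ (c , i))) → blues c ≡ r
  blues-all c b = trans (∑-cong λ i → ⟦⟧-true (B₀ (c , i)) (b i)) (trans (∑-const r 1) (*-identityʳ r))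

  blue⇒1≤blues : ∀ c i → T (B₀ (c , i)) → 1 ≤ blues c
  blue⇒1≤blues c i b = begin
    1                                           ≡⟨ ⟦⟧-true (❴ i ❵ i) (∈❴❵ i) ⟨
    ⟦ ❴ i ❵ i ⟧                                 ≡⟨ ∑-single _ i (λ j j≢i → ⟦⟧-false (❴ i ❵ j) (j≢i ∘ ∈❴❵⇒≡)) ⟨
    ∑ (λ j → ⟦ ❴ i ❵ j ⟧)                       ≤⟨ ∑-mono pointwise ⟩
    blues c                                     ∎
    where
    open ≤-Reasoning
    pointwise : ∀ j → ⟦ ❴ i ❵ j ⟧ ≤ ⟦ B₀ (c , j) ⟧
    pointwise j with j ≟ i
    ... | yes refl = ≤-reflexive (sym (⟦⟧-true (B₀ (c , j)) b))
    ... | no _     = z≤n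

  -- A single cluster has at most `r` white vertices, and a backforce touches only one. If an
  -- ordinary step forces two clusters, each has a neighbour `z` in the component of `x`. As `z` is
  -- adjacent to the whole cluster, all its white vertices are forced, and `AtMost` bounds their
  -- total number by `r`.
  whites-forced-≤ : ∀ {B l B′ l′} → Step G r (B , l) (B′ , l′) → (W : Fin n → Bool) →
    (∀ c → T (W c) → ClusterForced G r B B′ c × (∀ i → B (c , i) ⇔ T (B₀ (c , i)))) →
    ∑ (λ c → if W c then whites c else 0) ≤ r
  whites-forced-≤ {B} step W forced
    with any? (λ c → any? λ d → T? (W c) ×-dec T? (W d) ×-dec ¬? (c ≟ d))
  ... | no ¬two = ∑-if-≤ whites≤r λ c d c∈W d∈W →
    decidable-stable (c ≟ d) λ c≢d → ¬two (c , d , c∈W , d∈W , c≢d)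
  whites-forced-≤ {B} (back u _ B′⇔) W forced | yes (c , d , c∈W , d∈W , c≢d) =
    contradiction (trans (is-u c c∈W) (sym (is-u d d∈W))) c≢d
    where
    is-u : ∀ a → T (W a) → a ≡ proj₁ u
    is-u a a∈W with proj₁ (forced a a∈W)
    ... | (i , ¬b , b′) = [ (λ b → contradiction b ¬b) , id ]′ (to (B′⇔ _) b′)
  whites-forced-≤ {B} (force u x _ _ (xs , len , ⊆xs) _ B′⇔) W forced | yes (c , d , c∈W , d∈W , c≢d) = begin
    ∑ (λ a → if W a then whites a else 0)           ≤⟨ ∑-mono pointwise ⟩
    ∑ (λ a → ∑ (λ i → ⟦ W a ∧ not (B₀ (a , i)) ⟧))
      ≤⟨ ∑∑-≤-length (λ (a , i) → W a ∧ not (B₀ (a , i))) xs (λ v t → ⊆xs v (in-nbr v t)) ⟩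
    length xs                                       ≤⟨ len ⟩
    r                                               ∎
    where
    open ≤-Reasoning
    pointwise : ∀ a → (if W a then whites a else 0) ≤ ∑ (λ i → ⟦ W a ∧ not (B₀ (a , i)) ⟧)
    pointwise a with W a
    ... | true  = ≤-refl
    ... | false = z≤n
    forced-nbr : ∀ {a} → T (W a) → ∃ λ i → NbrIn G r B u x (a , i)
    forced-nbr {a} a∈W with proj₁ (forced a a∈W)
    ... | (i , ¬b , b′) = i , [ (λ b → contradiction b ¬b) , id ]′ (to (B′⇔ _) b′)
    -- If x itself lies in R_a, then a path from x to another cluster leaves R_a by an edge.
    last-edge : ∀ {v a} → Conn G r B x v → proj₁ v ≢ a → ∀ {i} → Conn G r B x (a , i) →
                ∃ λ z → Conn G r B x z × T (adj G (proj₁ z) a)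
    last-edge {v} {a} x~v v≢a (there x~y _ ya) = _ , x~y , ya
    last-edge {v} {a} x~v v≢a here = first-edge x~v v≢a
      where
      first-edge : ∀ {v} → Conn G r B x v → proj₁ v ≢ a → ∃ λ z → Conn G r B x z × T (adj G (proj₁ z) a)
      first-edge here v≢a = contradiction refl v≢a
      first-edge (there {y = y} {z} x~y ¬bz yz) z≢a with proj₁ y ≟ a
      ... | yes refl = z , there x~y ¬bz yz , T-adj-sym G yz
      ... | no y≢a   = first-edge x~y y≢a
    another : ∀ a → T (W a) → ∃ λ b → T (W b) × b ≢ a
    another a a∈W with c ≟ a
    ... | yes refl = d , d∈W , c≢d ∘ sym
    ... | no c≢a   = c , c∈W , c≢a
    in-nbr : ∀ v → T (W (proj₁ v) ∧ not (B₀ v)) → NbrIn G r B u x v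
    in-nbr (a , j) t with to T-∧ t
    ... | a∈W , ¬b₀ with forced-nbr a∈W | another a a∈W
    ...   | _ , ua , _ , x~a | b , b∈W , b≢a with forced-nbr b∈W
    ...     | _ , _ , _ , x~b with last-edge x~b b≢a x~a
    ...       | z , x~z , za = ua , ¬b , there x~z ¬b za
      where
      ¬b : ¬ B (a , j)
      ¬b = T-not⁻ ¬b₀ ∘ to (proj₂ (forced a a∈W) j)

  all-cluster : Fin n → Bool
  all-cluster c = all (λ i → B₀ (c , i)) (allFin r)

  not-all⇒white : ∀ c → ¬ T (all-cluster c) → ∃ λ i → ¬ T (B₀ (c , i))
  not-all⇒white c ¬all with any? (λ i → ¬? (T? (B₀ (c , i))))
  ... | yes p = p
  ... | no ¬p = contradiction (from (T-all _) λ i → decidable-stable (T? _) λ ¬b → ¬p (i , ¬b)) ¬all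

  -- The All clusters are accounted at first; having no white vertices, they leave the number of
  -- blue vertices as the budget. A blue vertex leaves at most `r - 1` white ones in its cluster,
  -- whence `e = 1`.
  IsForcingSet⇒Clears : IsForcingSet G r B₀ →
    ¬ ¬ ∃ λ D → ∃ λ ℓ → Clears G D ℓ × r * ∣ D ∣ + ℓ ≤ card G r B₀
  IsForcingSet⇒Clears (s , steps , all-blue) = ¬¬-map
    (λ (D , ℓ , _ , cl , cost) → D , ℓ , cl , (begin
      r * ∣ D ∣ + ℓ                    ≡⟨ cong (r * ∣ D ∣ +_) (*-identityˡ ℓ) ⟨
      r * ∣ D ∣ + 1 * ℓ                ≤⟨ cost ⟩
      ∑ blues + weight all-cluster     ≡⟨ cong (∑ blues +_) (∑-zero _ no-white) ⟩
      ∑ blues + 0                      ≡⟨ +-identityʳ _ ⟩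
      card G r B₀                      ∎))
    (extract steps all-blue all-cluster record
      { same = λ c _ i → mk⇔ id id ; white = not-all⇒white ; last∈ = λ _ () })
    where
    open ≤-Reasoning
    open Extraction G B₀ whites r 1 (∑ blues) (Step G r) id whites≤r
      (λ c i b → ≤-trans (+-monoʳ-≤ (whites c) (blue⇒1≤blues c i b))
                         (≤-reflexive (trans (+-comm (whites c) (blues c)) (blues+whites c))))
      (≤-reflexive (trans (*-comm r n) (sym (trans (sym (∑-+ blues whites))
        (trans (∑-cong blues+whites) (∑-const n r))))))
      whites-forced-≤
    no-white : ∀ c → (if all-cluster c then whites c else 0) ≡ 0
    no-white c with T? (all-cluster c)
    ... | yes t = trans (if-true {b = all-cluster c} t) (∑-zero _ λ i →
                    ⟦⟧-false (not (B₀ (c , i))) λ w → T-not⁻ w (to (T-all _) t i))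
    ... | no ¬t = if-false {b = all-cluster c} ¬t

  -- With unit weights and `e = 0` One clusters are free, and the initial budget is the number of
  -- All clusters. Uniqueness of the forced cluster bounds the weight added per step by one.
  ForcingOneClusterPerStep⇒Clears : ForcingOneClusterPerStep G r B₀ →
    ¬ ¬ ∃ λ D → ∃ λ ℓ → Clears G D ℓ × ∣ D ∣ ≤ numAll G r B₀
  ForcingOneClusterPerStep⇒Clears (s , steps , all-blue) = ¬¬-map
    (λ (D , ℓ , _ , cl , cost) → D , ℓ , cl ,
      ≤-trans (≤-reflexive (sym (trans (+-identityʳ _) (*-identityˡ ∣ D ∣)))) cost)
    (extract steps all-blue all-cluster record
      { same = λ c _ i → mk⇔ id id ; white = not-all⇒white ; last∈ = λ _ () })
    where
    open Extraction G B₀ (λ _ → 1) 1 0 0 (StepOne G r) proj₁ (λ _ → ≤-refl) (λ _ _ _ → ≤-refl)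
      (≤-reflexive (trans (*-comm 1 n) (sym (∑-const n 1))))
      (λ (_ , a , _ , unique) W forced → ∑-if-≤ (λ _ → ≤-refl) λ c d c∈W d∈W →
        trans (unique c (proj₁ (forced c c∈W))) (sym (unique d (proj₁ (forced d d∈W)))))

  numAll*r≤card : r * numAll G r B₀ ≤ card G r B₀
  numAll*r≤card = ≤-trans (≤-reflexive (sym (∑-* r (λ c → ⟦ all-cluster c ⟧)))) (∑-mono pointwise)
    where
    pointwise : ∀ c → r * ⟦ all-cluster c ⟧ ≤ blues c
    pointwise c with T? (all-cluster c)
    ... | yes t = ≤-reflexive (trans (cong (r *_) (⟦⟧-true (all-cluster c) t))
                    (trans (*-identityʳ r) (sym (blues-all c (to (T-all _) t)))))
    ... | no ¬t = ≤-trans (≤-reflexive (trans (cong (r *_) (⟦⟧-false (all-cluster c) ¬t)) (*-zeroʳ r))) z≤n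
-- From the game on clusters to the blowup

-- `pt` selects the blue vertex of a One cluster. Its existence also gives `1 ≤ r` as soon as the
-- graph has a vertex.
module Realisation {n r} (G : SimpleGraph n) (pt : Fin n → Fin r) where

  col : Subset n → Subset n → Vtx G r → Bool
  col D O (c , i) = lookup D c ∨ (lookup O c ∧ ❴ pt c ❵ i)

  Coloured : ColSet G r → Subset n → Subset n → Set
  Coloured B D O = ∀ v → B v ⇔ T (col D O v)

  col-D : ∀ D O {c} i → c ∈ˢ D → T (col D O (c , i))
  col-D D O i c∈D = from T-∨ (inj₁ c∈D)

  col-O : ∀ D O {c} → c ∈ˢ O → T (col D O (c , pt c))
  col-O D O {c} c∈O = from (T-∨ {lookup D c}) (inj₂ (from T-∧ (c∈O , ∈❴❵ (pt c))))

  col-cases : ∀ D O {c i} → T (col D O (c , i)) → c ∈ˢ D ⊎ (c ∈ˢ O × i ≡ pt c)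
  col-cases D O {c} t with to (T-∨ {lookup D c}) t
  ... | inj₁ c∈D = inj₁ c∈D
  ... | inj₂ t′ with to (T-∧ {lookup O c}) t′
  ...   | c∈O , i∈ = inj₂ (c∈O , ∈❴❵⇒≡ i∈)

  white⇒∉ : ∀ D O {B c i} → Coloured B D O → ¬ B (c , i) → c ∉ˢ D
  white⇒∉ D O {i = i} B≐ ¬b c∈D = ¬b (from (B≐ _) (col-D D O i c∈D))

  ∉⇒white : ∀ D O {B c} i → Coloured B D O → c ∉ˢ D → c ∉ˢ O → ¬ B (c , i)
  ∉⇒white D O i B≐ c∉D c∉O b = [ c∉D , c∉O ∘ proj₁ ]′ (col-cases D O (to (B≐ _) b))

  0<r : Fin n → 0 < r
  0<r w = ≤-trans (s≤s z≤n) (toℕ<n (pt w))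

  module Fill (B : ColSet G r) (last : Maybe (Vtx G r)) (D O : Subset n) (B≐ : Coloured B D O)
    (u : Vtx G r) (u-blue : B u) (w : Fin n) (w∉D : w ∉ˢ D) (w∉O : w ∉ˢ O) (uw : T (adj G (proj₁ u) w))
    (only-w : ∀ i v → NbrIn G r B u (w , i) v → proj₁ v ≡ w) where

    D′ : Subset n
    D′ = D [ w ]≔ true

    -- Ending in `just u` is what permits the backforce after a `leaf` move.
    Filled : Set₁
    Filled = Σ (ColSet G r) λ B′ → Star (StepOne G r) (B , last) (B′ , just u) × Coloured B′ D′ O

    w-white : ∀ i → ¬ B (w , i)
    w-white i = ∉⇒white D O i B≐ w∉D w∉O

    col-D′⁻ : ∀ c i → T (col D′ O (c , i)) → B (c , i) ⊎ c ≡ w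
    col-D′⁻ c i t with c ≟ w
    ... | yes c≡w = inj₂ c≡w
    ... | no c≢w with col-cases D′ O t
    ...   | inj₁ c∈D′         = inj₁ (from (B≐ _) (col-D D O i (∈-insert⁻ D w c≢w c∈D′)))
    ...   | inj₂ (c∈O , refl) = inj₁ (from (B≐ _) (col-O D O c∈O))

    col-D′⁺ : ∀ c i → B (c , i) ⊎ c ≡ w → T (col D′ O (c , i))
    col-D′⁺ c i (inj₂ refl) = col-D D′ O i (∈-insert D w)
    col-D′⁺ c i (inj₁ b) with col-cases D O (to (B≐ _) b)
    ... | inj₁ c∈D          = col-D D′ O i (∈-insert⁺ D w c∈D)
    ... | inj₂ (c∈O , refl) = col-O D′ O c∈O

    -- The white vertex `z` is adjacent to every vertex over `w` and joins them into one component;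
    -- by `only-w` the force colours these `r` vertices and nothing else.
    fill-at-once : (∃ λ z → T (adj G w (proj₁ z)) × ¬ B z) → Filled
    fill-at-once (z , wz , ¬bz) = T ∘ col D′ O , (step , one) ◅ ε , λ v → mk⇔ id id
      where
      reach : ∀ j → Conn G r B (w , pt w) (w , j)
      reach j = there (there here ¬bz wz) (w-white j) (T-adj-sym G wz)
      step : Step G r (B , last) (T ∘ col D′ O , just u)
      step = force u (w , pt w) u-blue (w-white _)
        (map (w ,_) (allFin r) , ≤-reflexive (trans (length-map (w ,_) (allFin r)) (length-tabulate {n = r} id)) ,
          λ (c , i) nbr → subst (λ a → (a , i) ∈ map (w ,_) (allFin r)) (sym (only-w _ _ nbr))
                            (∈-map⁺ (w ,_) (∈-allFin i)))
        ((w , pt w) , uw , w-white _ , here)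
        λ (c , i) → mk⇔
          (λ t → [ inj₁ , (λ { refl → inj₂ (uw , w-white i , reach i) }) ]′ (col-D′⁻ c i t))
          (λ b → col-D′⁺ c i ([ inj₁ , inj₂ ∘ only-w _ _ ]′ b))
      one : ExactlyOneForced G r B (T ∘ col D′ O)
      one = w , (pt w , w-white _ , col-D′⁺ w _ (inj₂ refl)) ,
        λ c (i , ¬b , t) → [ (λ b → contradiction b ¬b) , id ]′ (col-D′⁻ c i t)

    Stage : ℕ → ColSet G r
    Stage k v = B v ⊎ (proj₁ v ≡ w × toℕ (proj₂ v) < k)

    -- If all neighbours of w are blue, each white vertex of R_w is a component of its own.
    module _ (no-white : ¬ ∃ λ z → T (adj G w (proj₁ z)) × ¬ B z) where

      stage-step : ∀ {A l} k → k < r → (∀ v → A v ⇔ Stage k v) → StepOne G r (A , l) (Stage (suc k) , just u)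
      stage-step {A} {l} k k<r A≐ = force u (w , i) (from (A≐ u) (inj₁ u-blue)) ¬a
          ((w , i) ∷ [] , 0<r w , λ v (_ , _ , x~v) → here (alone x~v))
          ((w , i) , uw , ¬a , here) blue ,
        w , (i , ¬a , inj₂ (refl , i<)) ,
        λ c (j , ¬aj , s) → [ (λ b → contradiction (from (A≐ _) (inj₁ b)) ¬aj) , proj₁ ]′ s
        where
        i = fromℕ< k<r
        i< : toℕ i < suc k
        i< = s≤s (≤-reflexive (toℕ-fromℕ< k<r))
        ¬a : ¬ A (w , i)
        ¬a a = [ w-white i , (λ (_ , lt) → <-irrefl (toℕ-fromℕ< k<r) lt) ]′ (to (A≐ _) a)
        alone : ∀ {v} → Conn G r A (w , i) v → v ≡ (w , i)
        alone here = refl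
        alone (there x~y ¬az yz) with alone x~y
        ... | refl = contradiction (_ , yz , λ b → ¬az (from (A≐ _) (inj₁ b))) no-white
        blue : ∀ v → Stage (suc k) v ⇔ (A v ⊎ NbrIn G r A u (w , i) v)
        blue v = mk⇔ ⇒ ⇐
          where
          ⇒ : Stage (suc k) v → A v ⊎ NbrIn G r A u (w , i) v
          ⇒ (inj₁ b) = inj₁ (from (A≐ v) (inj₁ b))
          ⇒ (inj₂ (refl , s≤s j≤k)) with m≤n⇒m<n∨m≡n j≤k
          ... | inj₁ j<k = inj₁ (from (A≐ v) (inj₂ (refl , j<k)))
          ... | inj₂ j≡k with toℕ-injective (trans j≡k (sym (toℕ-fromℕ< k<r)))
          ...   | refl = inj₂ (uw , ¬a , here)
          ⇐ : A v ⊎ NbrIn G r A u (w , i) v → Stage (suc k) v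
          ⇐ (inj₁ a) = [ inj₁ , (λ (eq , lt) → inj₂ (eq , m<n⇒m<1+n lt)) ]′ (to (A≐ v) a)
          ⇐ (inj₂ (_ , _ , x~v)) with alone x~v
          ... | refl = inj₂ (refl , i<)

      stages : ∀ k → k < r → Star (StepOne G r) (B , last) (Stage (suc k) , just u)
      stages zero    k<r = stage-step 0 k<r (λ v → mk⇔ inj₁ [ id , (λ { (_ , ()) }) ]′) ◅ ε
      stages (suc k) k<r = stages k (<-trans (n<1+n k) k<r) ◅◅ (stage-step (suc k) k<r (λ v → mk⇔ id id) ◅ ε)

      fill-one-by-one : Filled
      fill-one-by-one = Stage r , star , λ (c , i) → mk⇔
        (λ s → col-D′⁺ c i ([ inj₁ , inj₂ ∘ proj₁ ]′ s))
        (λ t → [ inj₁ , (λ c≡w → inj₂ (c≡w , toℕ<n i)) ]′ (col-D′⁻ c i t))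
        where
        star : Star (StepOne G r) (B , last) (Stage r , just u)
        -- `stages k` colours `k + 1` vertices, hence the argument `r ∸ 1`.
        star = subst (λ k → Star (StepOne G r) (B , last) (Stage k , just u)) (m+[n∸m]≡n (0<r w))
                 (stages (r ∸ 1) (≤-reflexive (m+[n∸m]≡n (0<r w))))

    fill : Filled
    -- `B` is an arbitrary predicate, so the case split is made on the Boolean `col D O`.
    fill with any? (λ c → any? λ i → T? (adj G w c) ×-dec ¬? (T? (col D O (c , i))))
    ... | yes (c , i , wc , ¬t) = fill-at-once ((c , i) , wc , ¬t ∘ to (B≐ _))
    ... | no ¬nbr = fill-one-by-one λ ((c , i) , wc , ¬b) → ¬nbr (c , i , wc , ¬b ∘ from (B≐ _))

  ones : ∀ {D ℓ} → Clears G D ℓ → Subset n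
  ones (full _)               = ⊥
  ones (outer _ _ _ _ _ _ cl) = ones cl
  ones (leaf u _ _ _ _ _ cl)  = ones cl [ u ]≔ true

  -- The forcer of a `leaf` move lies outside the current `D`, and `D` only grows. Hence each forced
  -- `w` starts as a None cluster, and no vertex is counted twice in the cost.
  ones-∉ : ∀ {D ℓ} (cl : Clears G D ℓ) {c} → c ∈ˢ D → c ∉ˢ ones cl
  ones-∉ (full _) {c} _ c∈ = subst T (lookup-replicate c false) c∈
  ones-∉ {D} (outer _ w _ _ _ _ cl) c∈D = ones-∉ cl (∈-insert⁺ D w c∈D)
  ones-∉ {D} (leaf u w u∉ w∉ _ _ cl) {c} c∈D c∈ =
    ones-∉ cl (∈-insert⁺ (D [ w ]≔ true) u (∈-insert⁺ D w c∈D)) (∈-insert⁻ (ones cl) u (λ { refl → u∉ c∈D }) c∈)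

  ∣ones∣ : ∀ {D ℓ} (cl : Clears G D ℓ) → ∣ ones cl ∣ ≡ ℓ
  ∣ones∣ (full _)               = ∣⊥∣≡0 n
  ∣ones∣ (outer _ _ _ _ _ _ cl) = ∣ones∣ cl
  ∣ones∣ {D} (leaf u w _ _ _ _ cl) =
    trans (∣insert∣ (ones cl) u (ones-∉ cl (∈-insert (D [ w ]≔ true) u))) (cong suc (∣ones∣ cl))

  Finishes : State G r → Set₁
  Finishes s = Σ (State G r) λ t → Star (StepOne G r) s t × (∀ v → proj₁ t v)

  realise : ∀ {D ℓ} (cl : Clears G D ℓ) {B last} → Coloured B D (ones cl) → Finishes (B , last)
  realise {D} (full all∈) B≐ = _ , ε , λ (c , i) → from (B≐ _) (col-D D ⊥ i (all∈ c))
  realise {D} (outer u w S u∈ w∉ (isolates uw w∈S closed only) cl) {B} {last} B≐ =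
    let (B′ , steps , B′≐) = Fill.fill B last D O B≐ (u , pt u) (from (B≐ _) (col-D D O _ u∈)) w w∉
                               (ones-∉ cl (∈-insert D w)) uw
                               (λ i v (uv , ¬bv , x~v) → only _ (stays x~v) (white⇒∉ D O B≐ ¬bv) uv)
        (t , more , all-blue) = realise cl B′≐
    in t , steps ◅◅ more , all-blue
    where
    O = ones cl
    -- White vertices lie in clusters outside `D`, so `closed` keeps a white walk from `w` inside
    -- `S`.
    stays : ∀ {i v} → Conn G r B (w , i) v → proj₁ v ∈ˢ S
    stays here               = w∈S
    stays (there x~y ¬bz yz) = closed _ _ (stays x~y) (white⇒∉ D O B≐ ¬bz) yz
  realise {D} (leaf u w u∉ w∉ uw only cl) {B} {last} B≐ = finish (Fill.fill B last D O B≐ (u , pt u)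
      (from (B≐ _) (col-O D O (∈-insert (ones cl) u))) w w∉ w∉O uw
      (λ i v (uv , ¬bv , _) → only _ (white⇒∉ D O B≐ ¬bv) uv))
    where
    O = ones cl [ u ]≔ true
    D₁ = D [ w ]≔ true
    D₂ = D₁ [ u ]≔ true
    w≢u : w ≢ u
    w≢u = adj⇒≢ G uw ∘ sym
    w∉O : w ∉ˢ O
    w∉O w∈O = ones-∉ cl (∈-insert⁺ D₁ u (∈-insert D w)) (∈-insert⁻ (ones cl) u w≢u w∈O)
    col⁺ : ∀ c i → T (col D₁ O (c , i)) ⊎ c ≡ u → T (col D₂ (ones cl) (c , i))
    col⁺ c i (inj₂ refl) = col-D D₂ (ones cl) i (∈-insert D₁ u)
    col⁺ c i (inj₁ t) with c ≟ u | col-cases D₁ O t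
    ... | yes refl | _                  = col-D D₂ (ones cl) i (∈-insert D₁ u)
    ... | no _     | inj₁ c∈            = col-D D₂ (ones cl) i (∈-insert⁺ D₁ u c∈)
    ... | no c≢u   | inj₂ (c∈O , refl)  = col-O D₂ (ones cl) (∈-insert⁻ (ones cl) u c≢u c∈O)
    col⁻ : ∀ c i → T (col D₂ (ones cl) (c , i)) → T (col D₁ O (c , i)) ⊎ c ≡ u
    col⁻ c i t with c ≟ u | col-cases D₂ (ones cl) t
    ... | yes c≡u | _                 = inj₂ c≡u
    ... | no c≢u  | inj₁ c∈           = inj₁ (col-D D₁ O i (∈-insert⁻ D₁ u c≢u c∈))
    ... | no _    | inj₂ (c∈ , refl)  = inj₁ (col-O D₁ O (∈-insert⁺ (ones cl) u c∈))
    finish : (Σ (ColSet G r) λ B₁ → Star (StepOne G r) (B , last) (B₁ , just (u , pt u)) × Coloured B₁ D₁ O) →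
             Finishes (B , last)
    finish (B₁ , steps , B₁≐) with any? (λ i → ¬? (i ≟ pt u))
    -- Here `r = 1` and the One cluster is already entirely blue. Since `back` demands a white
    -- vertex, no step is inserted.
    ... | no r≤1 =
      let (t , more , all-blue) = realise cl λ (c , i) → mk⇔
            (λ b → col⁺ c i (inj₁ (to (B₁≐ _) b)))
            (λ t → from (B₁≐ _) ([ id , (λ { refl → u-all i }) ]′ (col⁻ c i t)))
      in t , steps ◅◅ more , all-blue
      where
      u-all : ∀ i → T (col D₁ O (u , i))
      u-all i with decidable-stable (i ≟ pt u) (λ i≢ → r≤1 (i , i≢))
      ... | refl = col-O D₁ O (∈-insert (ones cl) u)
    ... | yes (i , i≢) =
      let (t , more , all-blue) = realise cl {B₂} (λ v → mk⇔ id id)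
      in t , steps ◅◅ ((back (u , pt u) (i , ¬b) blue , one) ◅ more) , all-blue
      where
      B₂ : ColSet G r
      B₂ = T ∘ col D₂ (ones cl)
      ¬b : ¬ B₁ (u , i)
      ¬b b = [ u∉ ∘ ∈-insert⁻ D w (w≢u ∘ sym) , i≢ ∘ proj₂ ]′ (col-cases D₁ O (to (B₁≐ _) b))
      blue : ∀ v → B₂ v ⇔ (B₁ v ⊎ proj₁ v ≡ u)
      blue (c , j) = mk⇔ (λ t → [ inj₁ ∘ from (B₁≐ _) , inj₂ ]′ (col⁻ c j t))
                         (λ b → col⁺ c j ([ inj₁ ∘ to (B₁≐ _) , inj₂ ]′ b))
      one : ExactlyOneForced G r B₁ B₂
      one = u , (i , ¬b , col⁺ u i (inj₂ refl)) ,
        λ c (j , ¬bj , t) → [ (λ b → contradiction (from (B₁≐ _) b) ¬bj) , id ]′ (col⁻ c j t)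

  module _ {D ℓ} (cl : Clears G D ℓ) where

    colouring : Vtx G r → Bool
    colouring = col D (ones cl)

    colouring-one-per-step : ForcingOneClusterPerStep G r colouring
    colouring-one-per-step = realise cl λ v → mk⇔ id id

    colouring-forcing : IsForcingSet G r colouring
    colouring-forcing = let (t , steps , all-blue) = colouring-one-per-step in t , gmap id proj₁ steps , all-blue

    colouring-AON : IsAON G r colouring
    colouring-AON c with T? (lookup D c) | T? (lookup (ones cl) c)
    ... | yes c∈D | _       = inj₁ λ i → to T-≡ (col-D D (ones cl) i c∈D)
    ... | no c∉D  | yes c∈O = inj₂ (inj₁ (pt c , to T-≡ (col-O D (ones cl) c∈O) , λ j b →
      [ (λ c∈D → contradiction c∈D c∉D) , proj₂ ]′ (col-cases D (ones cl) (from T-≡ b))))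
    ... | no c∉D  | no c∉O  = inj₂ (inj₂ λ i → ¬T⇒≡false λ t →
      [ c∉D , c∉O ∘ proj₁ ]′ (col-cases D (ones cl) t))

    card-colouring : card G r colouring ≡ r * ∣ D ∣ + ℓ
    card-colouring = begin
      ∑ (λ c → ∑ λ i → ⟦ colouring (c , i) ⟧)                      ≡⟨ ∑-cong per-cluster ⟩
      ∑ (λ c → r * ⟦ lookup D c ⟧ + ⟦ lookup (ones cl) c ⟧)        ≡⟨ ∑-+ (λ c → r * ⟦ lookup D c ⟧) _ ⟩
      ∑ (λ c → r * ⟦ lookup D c ⟧) + ∑ (λ c → ⟦ lookup (ones cl) c ⟧)
        ≡⟨ cong₂ _+_ (trans (∑-* r (λ c → ⟦ lookup D c ⟧)) (cong (r *_) (∑-∣∣ D)))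
                     (trans (∑-∣∣ (ones cl)) (∣ones∣ cl)) ⟩
      r * ∣ D ∣ + ℓ                                                ∎
      where
      open ≡-Reasoning
      per-cluster : ∀ c → ∑ (λ i → ⟦ colouring (c , i) ⟧) ≡ r * ⟦ lookup D c ⟧ + ⟦ lookup (ones cl) c ⟧
      per-cluster c with T? (lookup D c) | T? (lookup (ones cl) c)
      ... | yes c∈D | _ = trans (blues-all G colouring c λ i → col-D D (ones cl) i c∈D) (sym (begin
        r * ⟦ lookup D c ⟧ + ⟦ lookup (ones cl) c ⟧
          ≡⟨ cong₂ (λ x y → r * x + y) (⟦⟧-true (lookup D c) c∈D) (⟦⟧-false (lookup (ones cl) c) (ones-∉ cl c∈D)) ⟩
        r * 1 + 0   ≡⟨ trans (+-identityʳ _) (*-identityʳ r) ⟩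
        r           ∎))
      ... | no c∉D | yes c∈O = trans
        (trans (∑-single _ (pt c) λ i i≢ → ⟦⟧-false (colouring (c , i)) λ t →
                  [ c∉D , i≢ ∘ proj₂ ]′ (col-cases D (ones cl) t))
               (⟦⟧-true (colouring (c , pt c)) (col-O D (ones cl) c∈O)))
        (sym (trans (cong₂ (λ x y → r * x + y) (⟦⟧-false (lookup D c) c∉D) (⟦⟧-true (lookup (ones cl) c) c∈O))
                    (cong (_+ 1) (*-zeroʳ r))))
      ... | no c∉D | no c∉O = trans
        (∑-zero _ λ i → ⟦⟧-false (colouring (c , i)) λ t → [ c∉D , c∉O ∘ proj₁ ]′ (col-cases D (ones cl) t))
        (sym (trans (cong₂ (λ x y → r * x + y) (⟦⟧-false (lookup D c) c∉D) (⟦⟧-false (lookup (ones cl) c) c∉O))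
                    (cong (_+ 0) (*-zeroʳ r))))

-- Optimal AON sets and the fractional parameter

optimal-AON : (G : SimpleGraph n) (pt : Fin n → Fin r) → ∃ λ B → IsOptimalAON G r B
optimal-AON {r = r} G pt with optimal G r
... | D , ℓ , cl , minimal = colouring cl , colouring-AON cl , colouring-forcing cl ,
    ((colouring cl , colouring-forcing cl , refl) , λ B forcing →
      -- Any forcing set yields a winning pair at no greater cost, and the chosen pair is the
      -- cheapest.
      decidable-stable (_ ≤? _) (¬¬-map
        (λ (D′ , ℓ′ , cl′ , cost) → ≤-trans (≤-reflexive (card-colouring cl)) (≤-trans (minimal D′ ℓ′ cl′) cost))
        (IsForcingSet⇒Clears G B forcing))) ,
    colouring-one-per-step cl
  where open Realisation G pt

IsZ-≤ : (G : SimpleGraph n) (pt : Fin n → Fin r) → ∀ {k D ℓ} → IsZ G r k → Clears G D ℓ → k ≤ r * ∣ D ∣ + ℓ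
IsZ-≤ G pt (_ , min) cl = ≤-trans (min (colouring cl) (colouring-forcing cl)) (≤-reflexive (card-colouring cl))
  where open Realisation G pt

-- Division by `k`: a remainder below `k` cannot raise the quotient.
*-cancel-<+ : ∀ k a b c → c < k → k * a ≤ k * b + c → a ≤ b
*-cancel-<+ k a b c c<k ka≤ = ≤-pred (*-cancelˡ-< k a (suc b) (begin-strict
  k * a      ≤⟨ ka≤ ⟩
  k * b + c  <⟨ +-monoʳ-< (k * b) c<k ⟩
  k * b + k  ≡⟨ trans (+-comm (k * b) k) (sym (*-suc k b)) ⟩
  k * suc b  ∎))
  where open ≤-Reasoning

module _ (G : SimpleGraph n) (0<n : 0 < n) {B : Vtx G n → Bool} (opt : IsOptimalAON G n B) where

  -- Minimality of `B` at `r = n` puts `n * numAll G n B` below `n * ∣ D ∣ + ℓ`, and `ℓ < n`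
  -- disappears on division by `n`.
  numAll≤∣D∣ : ∀ {D ℓ} → Clears G D ℓ → numAll G n B ≤ ∣ D ∣
  numAll≤∣D∣ {D} {ℓ} cl = *-cancel-<+ n _ _ ℓ (Clears⇒ℓ<n G 0<n cl)
    (≤-trans (numAll*r≤card G B) (IsZ-≤ G id (proj₁ (proj₂ (proj₂ opt))) cl))

  -- A forcing set for any `r` yields a win in the same game, so its `D` is subject to the
  -- comparison made at `r = n`.
  lower-bound : ∀ r → 1 ≤ r → ∀ k → IsZ G r k → numAll G n B * r ≤ k
  lower-bound r _ k ((B′ , forcing , refl) , _) = decidable-stable (_ ≤? _) (¬¬-map
    (λ (D , ℓ , cl , cost) → (begin
      numAll G n B * r ≤⟨ *-monoˡ-≤ r (numAll≤∣D∣ cl) ⟩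
      ∣ D ∣ * r        ≡⟨ *-comm ∣ D ∣ r ⟩
      r * ∣ D ∣        ≤⟨ m≤m+n _ ℓ ⟩
      r * ∣ D ∣ + ℓ    ≤⟨ cost ⟩
      k                ∎))
    (IsForcingSet⇒Clears G B′ forcing))
    where open ≤-Reasoning

  -- Z_(r) ≤ r a + n, so at r = m = n q + 1 the error n q is too small to separate p / q from a.
  greatest : ∀ p q → 1 ≤ q → (∀ r → 1 ≤ r → ∀ k → IsZ G r k → p * r ≤ k * q) → p ≤ numAll G n B * q
  greatest p q 1≤q p/q≤ = decidable-stable (_ ≤? _) (¬¬-map
    (λ (D , ℓ , cl , D≤a) → *-cancel-<+ m p (a * q) (n * q) (n<1+n _) (begin
      m * p                  ≡⟨ *-comm m p ⟩
      p * m                  ≤⟨ p/q≤ m (s≤s z≤n) k isZ ⟩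
      k * q                  ≤⟨ *-monoˡ-≤ q (IsZ-≤ G pt isZ cl) ⟩
      (m * ∣ D ∣ + ℓ) * q    ≤⟨ *-monoˡ-≤ q (+-mono-≤ (*-monoʳ-≤ m D≤a) (<⇒≤ (Clears⇒ℓ<n G 0<n cl))) ⟩
      (m * a + n) * q        ≡⟨ trans (*-distribʳ-+ q (m * a) n) (cong (_+ n * q) (*-assoc m a q)) ⟩
      m * (a * q) + n * q    ∎))
    -- The process that starts from `B` supplies a winning `D` of at most `a` clusters.
    (ForcingOneClusterPerStep⇒Clears G B (proj₂ (proj₂ (proj₂ opt)))))
    where
    open ≤-Reasoning
    a = numAll G n B
    m = suc (n * q)
    pt : Fin n → Fin m
    pt _ = zero
    k = card G m (proj₁ (optimal-AON G pt))
    isZ : IsZ G m k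
    isZ = proj₁ (proj₂ (proj₂ (proj₂ (optimal-AON G pt))))

theorem2p17 : ∀ {n} (G : SimpleGraph n) →
    Σ (Vtx G n → Bool) (λ B → IsOptimalAON G n B)
    × (∀ B → IsOptimalAON G n B → IsZfPlus G (numAll G n B))
theorem2p17 {zero}  G = optimal-AON G id , λ B opt →
  (λ _ _ _ _ → z≤n) ,
  -- Without vertices `Z_(1) = 0`, so the hypothesis at `r = 1` says `p ≤ 0`.
  λ p q _ p/q≤ → subst (_≤ 0) (*-identityʳ p)
    (p/q≤ 1 ≤-refl 0 (((λ ()) , (_ , ε , λ { (() , _) }) , refl) , λ _ _ → z≤n))
theorem2p17 {suc n} G = optimal-AON G id , λ B opt →
  lower-bound G (s≤s z≤n) opt , greatest G (s≤s z≤n) opt
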